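{- In the unit-length offline setting, where all intervals have identical lengths and arbitrary nonnegative weights, no EF1 scheduling algorithm can achieve a price of fairness strictly smaller than $\tfrac32$: for every offline EF1 scheduling algorithm $\mathrm{ALG}$ (taking the number of machines and the instance as input) and every $\alpha<\tfrac32$ there exist a number of machines $m$ and an instance $\mathcal I$ of intervals all of the same length, with nonnegative weights, such that $$w(\mathrm{OPT}(\mathcal I))\;>\;\alpha\,w(\mathrm{ALG}(\mathcal I)).$$
   Context: An instance $\mathcal I$ is a finite indexed family of intervals $I_1,\dots,I_n$ (identical intervals may occur several times). Interval $I_j$ has a start time $s_j$ and an end time $e_j$, $s_j<e_j$, both nonnegative rationals, and a nonnegative weight $w(I_j)$; it is identified with the half-open set $[s_j,e_j)$ and its length is $e_j-s_j$. Two intervals overlap (conflict) if these sets intersect. Machines are $1,\dots,m$. A schedule assigns a subset of the intervals to machines (each accepted interval to exactly one machine; intervals may be left unassigned) so that no two intervals on the same machine overlap. $S_i$ is the set of intervals assigned to machine $i$; $w(X)=\sum_{I\in X}w(I)$ is the total weight of a set $X$ of intervals, and the weight of a schedule is the total weight of its assigned intervals. $\mathrm{OPT}(\mathcal I)$ is a schedule of maximum total weight on the $m$ machines, with no fairness requirement. A schedule is EF1 (envy-free up to one interval) if for every pair of machines $i\ne k$ with $S_k\neq\emptyset$ there is $I\in S_k$ such that $w(S_i)\ge w(S_k)-w(I)$. An offline EF1 scheduling algorithm is any map sending $m$ and an instance (given in full in advance) to an EF1 schedule of it on $m$ machines. Its price of fairness is the smallest $\alpha$ such that $w(\mathrm{OPT}(\mathcal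 I))\le\alpha\,w(\mathrm{ALG}(\mathcal I))$ for every instance, the worst case being over all instances and all numbers of machines. -}

module Defs where

open import Algebra.Properties.CommutativeMonoid.Sum using (sum)
open import Data.Bool using (if_then_else_)
open import Data.Fin using (Fin)
import Data.Fin.Properties as Fin
open import Data.Fin.Subset using (Subset; Nonempty; _∈_)
open import Data.Maybe using (Maybe; just; is-just)
import Data.Maybe.Properties as Maybe
open import Data.Nat using (ℕ)
open import Data.Product using (∃-syntax; _×_)
open import Data.Rational using (ℚ; 0ℚ; _≤_; _<_; _≥_; _-_)
open import Data.Rational.Properties using (+-0-commutativeMonoid)
open import Data.Vec using (lookup; tabulate)
open import Relation.Binary.PropositionalEquality using (_≡_; _≢_)
open import Relation.Nullary using (¬_; does)

record Interval : Set where
  field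
    start end weight : ℚ
    0≤start   : 0ℚ ≤ start
    start<end : start < end
    0≤weight  : 0ℚ ≤ weight

  length : ℚ
  length = end - start

open Interval public

infix 4 _∈ᴵ_

_∈ᴵ_ : ℚ → Interval → Set
t ∈ᴵ I = start I ≤ t × t < end I

-- Intervals with rational endpoints meet in ℝ exactly when they share a
-- rational point (the larger of the two start times).
Overlap : Interval → Interval → Set
Overlap I J = ∃[ t ] (t ∈ᴵ I × t ∈ᴵ J)

record Instance : Set where
  field
    size     : ℕ
    interval : Fin size → Interval

open Instance public

EqualLengths : Instance → Set
EqualLengths 𝓘 = ∀ j k → length (interval 𝓘 j) ≡ length (interval 𝓘 k)

-- Sets of intervals are sets of indices, so identical intervals occurring
-- several times are counted separately.
w : (𝓘 : Instance) → Subset (size 𝓘) → ℚ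
w 𝓘 X = sum +-0-commutativeMonoid
  λ j → if lookup X j then weight (interval 𝓘 j) else 0ℚ

record Schedule (m : ℕ) (𝓘 : Instance) : Set where
  field
    -- nothing: the interval is left unassigned
    machine   : Fin (size 𝓘) → Maybe (Fin m)
    noOverlap : ∀ {j k i} → j ≢ k → machine j ≡ just i → machine k ≡ just i →
                ¬ Overlap (interval 𝓘 j) (interval 𝓘 k)

  assignedTo : Fin m → Subset (size 𝓘)
  assignedTo i = tabulate λ j → does (Maybe.≡-dec Fin._≟_ (machine j) (just i))

  accepted : Subset (size 𝓘)
  accepted = tabulate λ j → is-just (machine j)

  totalWeight : ℚ
  totalWeight = w 𝓘 accepted

open Schedule public

EF1 : ∀ {m 𝓘} → Schedule m 𝓘 → Set
EF1 {m} {𝓘} S = ∀ (i k : Fin m) → i ≢ k → Nonempty (assignedTo S k) →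
  ∃[ j ] (j ∈ assignedTo S k ×
          w 𝓘 (assignedTo S i) ≥ w 𝓘 (assignedTo S k) - weight (interval 𝓘 j))

IsOPT : ∀ {m 𝓘} → Schedule m 𝓘 → Set
IsOPT {m} {𝓘} O = ∀ (S : Schedule m 𝓘) → totalWeight S ≤ totalWeight O

record OfflineEF1Algorithm : Set where
  field
    schedule : ∀ m 𝓘 → Schedule m 𝓘
    ef1      : ∀ m 𝓘 → EF1 (schedule m 𝓘)

open OfflineEF1Algorithm public

{-# OPTIONS --safe #-}
-- Take two machines and three intervals of length 2 in which a middle interval
-- M of weight x < 1 overlaps two disjoint intervals L and R of weight 1.  The
-- only way to accept all three is to put L and R together on one machine, and
-- then the machine holding M envies even after L or R is removed.  Hence an EF1
-- schedule weighs at most 2, whereas the optimum is 2 + x, and x → 1 gives 3/2.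
module Submission where

open import Defs
open import Algebra.Properties.CommutativeMonoid.Sum using (sum)
open import Data.Bool using (true; false; if_then_else_)
open import Data.Fin using (Fin; zero; suc)
open import Data.Fin.Patterns using (0F; 1F; 2F)
import Data.Fin.Properties as Fin
open import Data.Integer using (+_)
open import Data.Maybe using (Maybe; just; nothing; is-just)
import Data.Maybe.Properties as Maybe
open import Data.Nat using (ℕ; zero; suc)
open import Data.Product using (Σ-syntax; _×_; _,_)
open import Data.Rational
  using (ℚ; 0ℚ; 1ℚ; _<_; _>_; _≤_; _*_; _/_; _+_; _-_; -_; _⊔_; nonNegative)
open import Data.Rational.Properties
open import Data.Rational.Solver using (module +-*-Solver)
open import Data.Sum using (inj₁; inj₂)
open import Data.Vec using (lookup)
open import Data.Vec.Properties using (lookup⇒[]=)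
open import Function using (_∘_)
open import Relation.Binary.PropositionalEquality using (_≡_; _≢_; refl; sym; trans; cong; subst)
open import Relation.Nullary using (¬_; yes; no; contradiction)
open import Relation.Nullary.Decidable using (dec-true; dec-false; from-yes)

2ℚ : ℚ
2ℚ = + 2 / 1

sum-mono-≤ : ∀ {n} {f g : Fin n → ℚ} → (∀ j → f j ≤ g j) →
             sum +-0-commutativeMonoid f ≤ sum +-0-commutativeMonoid g
sum-mono-≤ {zero}  f≤g = ≤-refl
sum-mono-≤ {suc n} f≤g = +-mono-≤ (f≤g zero) (sum-mono-≤ λ j → f≤g (suc j))

if-≤ : ∀ {p} → 0ℚ ≤ p → ∀ b → (if b then p else 0ℚ) ≤ p
if-≤ 0≤p true  = ≤-refl
if-≤ 0≤p false = 0≤p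

0≤if : ∀ {p} → 0ℚ ≤ p → ∀ b → 0ℚ ≤ (if b then p else 0ℚ)
0≤if 0≤p true  = 0≤p
0≤if 0≤p false = ≤-refl

-- Pigeonhole on two machines: if L and R both avoid the machine of M, they share the other one.
≢-≢⇒≡ : {a b c : Fin 2} → a ≢ b → b ≢ c → a ≡ c
≢-≢⇒≡ {0F} {_}  {0F} _   _   = refl
≢-≢⇒≡ {1F} {_}  {1F} _   _   = refl
≢-≢⇒≡ {0F} {0F} {1F} a≢b _   = contradiction refl a≢b
≢-≢⇒≡ {0F} {1F} {1F} _   b≢c = contradiction refl b≢c
≢-≢⇒≡ {1F} {1F} {0F} a≢b _   = contradiction refl a≢b
≢-≢⇒≡ {1F} {0F} {0F} _   b≢c = contradiction refl b≢c

⊔-lub-< : ∀ {p q r} → p < r → q < r → p ⊔ q < r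
⊔-lub-< {p} {q} {r} p<r q<r with ⊔-sel p q
... | inj₁ eq = subst (_< r) (sym eq) p<r
... | inj₂ eq = subst (_< r) (sym eq) q<r

module PathInstance (x : ℚ) (0≤x : 0ℚ ≤ x) (x<1 : x < 1ℚ) where

  -- The indices `0F`, `1F`, `2F` stand for L, M, R. L ends exactly where R starts, so half-openness
  -- keeps these two disjoint while M meets both.
  ivl : Fin 3 → Interval
  ivl 0F = record
    { start = 0ℚ ; end = 2ℚ ; weight = 1ℚ ; 0≤start = ≤-refl
    ; start<end = from-yes (0ℚ <? 2ℚ) ; 0≤weight = from-yes (0ℚ ≤? 1ℚ) }
  ivl 1F = record
    { start = 1ℚ ; end = + 3 / 1 ; weight = x ; 0≤start = from-yes (0ℚ ≤? 1ℚ)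
    ; start<end = from-yes (1ℚ <? + 3 / 1) ; 0≤weight = 0≤x }
  ivl 2F = record
    { start = 2ℚ ; end = + 4 / 1 ; weight = 1ℚ ; 0≤start = from-yes (0ℚ ≤? 2ℚ)
    ; start<end = from-yes (2ℚ <? + 4 / 1) ; 0≤weight = from-yes (0ℚ ≤? 1ℚ) }

  path : Instance
  path = record { size = 3 ; interval = ivl }

  length-ivl : ∀ j → length (ivl j) ≡ 2ℚ
  length-ivl 0F = refl
  length-ivl 1F = refl
  length-ivl 2F = refl

  weight-ivl≤1 : ∀ j → weight (ivl j) ≤ 1ℚ
  weight-ivl≤1 0F = ≤-refl
  weight-ivl≤1 1F = <⇒≤ x<1
  weight-ivl≤1 2F = ≤-refl

  overlap₀₁ : Overlap (ivl 0F) (ivl 1F)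
  overlap₀₁ = 1ℚ , (from-yes (0ℚ ≤? 1ℚ) , from-yes (1ℚ <? 2ℚ))
                 , (≤-refl , from-yes (1ℚ <? + 3 / 1))

  overlap₁₂ : Overlap (ivl 1F) (ivl 2F)
  overlap₁₂ = 2ℚ , (from-yes (1ℚ ≤? 2ℚ) , from-yes (2ℚ <? + 3 / 1))
                 , (≤-refl , from-yes (2ℚ <? + 4 / 1))

  optMachine : Fin 3 → Maybe (Fin 2)
  optMachine 1F = just 1F
  optMachine _  = just 0F

  opt-noOverlap : ∀ {j k i} → j ≢ k → optMachine j ≡ just i → optMachine k ≡ just i →
                  ¬ Overlap (ivl j) (ivl k)
  opt-noOverlap {0F} {0F} j≢k _ _ _ = j≢k refl
  opt-noOverlap {1F} {1F} j≢k _ _ _ = j≢k refl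
  opt-noOverlap {2F} {2F} j≢k _ _ _ = j≢k refl
  opt-noOverlap {0F} {2F} _ _ _ (t , (_ , t<2) , (2≤t , _)) = <-irrefl refl (<-≤-trans t<2 2≤t)
  opt-noOverlap {2F} {0F} _ _ _ (t , (2≤t , _) , (_ , t<2)) = <-irrefl refl (<-≤-trans t<2 2≤t)
  opt-noOverlap {0F} {1F} _ refl ()
  opt-noOverlap {1F} {0F} _ refl ()
  opt-noOverlap {1F} {2F} _ refl ()
  opt-noOverlap {2F} {1F} _ refl ()

  opt : Schedule 2 path
  opt = record { machine = optMachine ; noOverlap = λ {j} {k} → opt-noOverlap {j} {k} }

  -- Since `opt` accepts every interval, its sum bounds that of any schedule term by term.
  opt-isOPT : IsOPT opt
  opt-isOPT S = sum-mono-≤ λ j → if-≤ (0≤weight (ivl j)) (lookup (accepted S) j)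

  totalWeight-opt : totalWeight opt ≡ 2ℚ + x
  totalWeight-opt = solve 1 (λ y → con 1ℚ :+ (y :+ con 1ℚ) := con 2ℚ :+ y) refl x
    where open +-*-Solver

  0≤totalWeight : ∀ {m} (S : Schedule m path) → 0ℚ ≤ totalWeight S
  -- The sum of three zeros computes to `0ℚ`, so comparing summands suffices.
  0≤totalWeight S = sum-mono-≤ {f = λ _ → 0ℚ} λ j → 0≤if (0≤weight (ivl j)) (lookup (accepted S) j)

  contribution≤1 : ∀ {m} (S : Schedule m path) j →
                   (if is-just (machine S j) then weight (ivl j) else 0ℚ) ≤ 1ℚ
  contribution≤1 S j =
    ≤-trans (if-≤ (0≤weight (ivl j)) (is-just (machine S j))) (weight-ivl≤1 j)

  -- The rejected interval contributes `0ℚ` and the other two at most `1ℚ` each; the resulting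
  -- numeral sums compute to `2ℚ`.
  rejection-bound : ∀ {m} (S : Schedule m path) j → machine S j ≡ nothing →
                    totalWeight S ≤ 2ℚ
  rejection-bound S 0F eq rewrite eq =
    +-monoʳ-≤ 0ℚ (+-mono-≤ (contribution≤1 S 1F) (+-monoˡ-≤ 0ℚ (contribution≤1 S 2F)))
  rejection-bound S 1F eq rewrite eq =
    +-mono-≤ (contribution≤1 S 0F) (+-monoʳ-≤ 0ℚ (+-monoˡ-≤ 0ℚ (contribution≤1 S 2F)))
  rejection-bound S 2F eq rewrite eq =
    +-mono-≤ (contribution≤1 S 0F) (+-monoˡ-≤ (0ℚ + 0ℚ) (contribution≤1 S 1F))

  weight-both : (S : Schedule 2 path) (i k : Fin 2) → i ≢ k →
                machine S 0F ≡ just k → machine S 1F ≡ just i → machine S 2F ≡ just k →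
                w path (assignedTo S k) ≡ 2ℚ
  weight-both S i k i≢k eq₀ eq₁ eq₂
    rewrite eq₀ | eq₁ | eq₂ | dec-true (k Fin.≟ k) refl | dec-false (i Fin.≟ k) i≢k = refl

  weight-middle : (S : Schedule 2 path) (i k : Fin 2) → i ≢ k →
                  machine S 0F ≡ just k → machine S 1F ≡ just i → machine S 2F ≡ just k →
                  w path (assignedTo S i) ≡ x
  weight-middle S i k i≢k eq₀ eq₁ eq₂
    rewrite eq₀ | eq₁ | eq₂ | dec-true (i Fin.≟ i) refl | dec-false (k Fin.≟ i) (i≢k ∘ sym)
    = trans (+-identityˡ (x + 0ℚ)) (+-identityʳ x)

  -- Whichever interval `j` is removed, it weighs at most `1ℚ`, so machine `k` keeps at least `1ℚ`,
  -- more than the `x` on machine `i`.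
  envy : (S : Schedule 2 path) (i k : Fin 2) → i ≢ k →
         machine S 0F ≡ just k → machine S 1F ≡ just i → machine S 2F ≡ just k → ¬ EF1 S
  envy S i k i≢k eq₀ eq₁ eq₂ ef
    with j , _ , ge ← ef i k i≢k (0F , lookup⇒[]= 0F (assignedTo S k)
                        (dec-true (Maybe.≡-dec Fin._≟_ (machine S 0F) (just k)) eq₀))
    -- As `2ℚ - 1ℚ` computes to `1ℚ`, the chain ends in the absurd `1ℚ < 1ℚ`.
    = <-irrefl refl (begin-strict
        2ℚ - 1ℚ  ≤⟨ +-monoʳ-≤ 2ℚ (neg-antimono-≤ (weight-ivl≤1 j)) ⟩
        2ℚ - weight (ivl j)  ≡⟨ cong (_- weight (ivl j)) (weight-both S i k i≢k eq₀ eq₁ eq₂) ⟨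
        w path (assignedTo S k) - weight (ivl j)  ≤⟨ ge ⟩
        w path (assignedTo S i)  ≡⟨ weight-middle S i k i≢k eq₀ eq₁ eq₂ ⟩
        x  <⟨ x<1 ⟩
        1ℚ  ∎)
    where open ≤-Reasoning

  -- Either some interval is rejected, or the overlaps keep M apart from L and from R, which forces
  -- the envious assignment.
  EF1-bound : (S : Schedule 2 path) → EF1 S → totalWeight S ≤ 2ℚ
  EF1-bound S ef = cases (machine S 0F) (machine S 1F) (machine S 2F) refl refl refl
    where
    cases : ∀ a b c → machine S 0F ≡ a → machine S 1F ≡ b → machine S 2F ≡ c →
            totalWeight S ≤ 2ℚ
    cases nothing _ _ eq₀ _ _ = rejection-bound S 0F eq₀
    cases _ nothing _ _ eq₁ _ = rejection-bound S 1F eq₁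
    cases _ _ nothing _ _ eq₂ = rejection-bound S 2F eq₂
    cases (just a) (just b) (just c) eq₀ eq₁ eq₂ with a Fin.≟ b | b Fin.≟ c
    ... | yes refl | _        = contradiction overlap₀₁ (noOverlap S (λ ()) eq₀ eq₁)
    ... | no _     | yes refl = contradiction overlap₁₂ (noOverlap S (λ ()) eq₁ eq₂)
    ... | no a≢b   | no b≢c   = contradiction ef
      (envy S b a (a≢b ∘ sym) eq₀ eq₁ (trans eq₂ (cong just (sym (≢-≢⇒≡ a≢b b≢c)))))

-- Replacing `α` by `α ⊔ 1ℚ` covers small and negative `α`: it makes the factor nonnegative, so that
-- the bound `2ℚ` can be multiplied by it, and it keeps the middle weight nonnegative. The gap up to
-- `β` makes the final inequality strict.
exceeds-below-3/2 : ∀ (ALG : OfflineEF1Algorithm) (α β : ℚ) → α ⊔ 1ℚ < β → β < + 3 / 2 →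
  Σ[ m ∈ ℕ ] Σ[ 𝓘 ∈ Instance ] Σ[ OPT ∈ Schedule m 𝓘 ]
    (EqualLengths 𝓘 × IsOPT OPT × totalWeight OPT > α * totalWeight (schedule ALG m 𝓘))
exceeds-below-3/2 ALG α β γ<β β<3/2
  = 2 , path , opt
  , (λ j k → trans (length-ivl j) (sym (length-ivl k)))
  , opt-isOPT
  , (begin-strict
      α * W  ≤⟨ *-monoʳ-≤-nonNeg W {{nonNegative (0≤totalWeight S)}} (p≤p⊔q α 1ℚ) ⟩
      γ * W  ≤⟨ *-monoˡ-≤-nonNeg γ {{nonNegative (≤-trans (from-yes (0ℚ ≤? 1ℚ)) 1≤γ)}}
                             (EF1-bound S (ef1 ALG 2 path)) ⟩
      γ * 2ℚ  <⟨ *-monoˡ-<-pos 2ℚ γ<β ⟩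
      β * 2ℚ  ≡⟨ solve 1 (λ b → b :* con 2ℚ := con 2ℚ :+ (b :* con 2ℚ :- con 2ℚ)) refl β ⟩
      2ℚ + x  ≡⟨ totalWeight-opt ⟨
      totalWeight opt ∎)
  where
  open ≤-Reasoning
  open +-*-Solver
  γ x : ℚ
  γ = α ⊔ 1ℚ
  -- chosen so that 2 + x = 2β
  x = β * 2ℚ - 2ℚ
  1≤γ : 1ℚ ≤ γ
  1≤γ = p≤q⊔p α 1ℚ
  -- The map sending b to 2b - 2 takes 1 to 0 and 3/2 to 1 by computation, so `1ℚ ≤ β` and
  -- `β < + 3 / 2` turn into the two bounds on `x`.
  0≤x : 0ℚ ≤ x
  0≤x = +-monoˡ-≤ (- 2ℚ) (*-monoʳ-≤-nonNeg 2ℚ (≤-trans 1≤γ (<⇒≤ γ<β)))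
  x<1 : x < 1ℚ
  x<1 = +-monoˡ-< (- 2ℚ) (*-monoˡ-<-pos 2ℚ β<3/2)
  open PathInstance x 0≤x x<1
  S : Schedule 2 path
  S = schedule ALG 2 path
  W : ℚ
  W = totalWeight S

theorem3 : ∀ (ALG : OfflineEF1Algorithm) (α : ℚ) → α < + 3 / 2 →
    Σ[ m ∈ ℕ ] Σ[ 𝓘 ∈ Instance ] Σ[ OPT ∈ Schedule m 𝓘 ]
    (EqualLengths 𝓘 × IsOPT OPT ×
    totalWeight OPT > α * totalWeight (schedule ALG m 𝓘))
theorem3 ALG α α<3/2
  with β , γ<β , β<3/2 ← <-dense (⊔-lub-< α<3/2 (from-yes (1ℚ <? + 3 / 2)))
  = exceeds-below-3/2 ALG α β γ<β β<3/2
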